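{- Let $k$ be an infinite field, $\tau_1,\tau_2$ $k$-linear endomorphisms of $k^m$ with matrices $T_1,T_2$ in the canonical basis, and $\rho$ an idempotent endomorphism of $k^m$ with $\operatorname{im}(\rho)=\operatorname{im}(\tau_2)$, with matrix $R$. Let $\ell=\dim_k\operatorname{im}(\tau_2)$ and let $H\subseteq k^m$ be an $\ell$-dimensional subspace with $H\cap\ker(\tau_2)=0$, so that $\tau_2|_H:H\to\operatorname{im}(\tau_2)$ is an isomorphism. Let $\tau_H=(\tau_2|_H)^{ -1}\rho\,\tau_1|_H$, an endomorphism of $H$. Let $B_H\in k^{m\times\ell}$ be a matrix whose columns form a basis of $H$, and let $T_H\in k^{\ell\times\ell}$ be the matrix of $\tau_H$ in this basis, i.e. $\tau_H(B_Hz)=B_HT_Hz$ for all $z\in k^\ell$. Let $k[z]=k[z_1,\dots,z_\ell]$, $z=(z_1,\dots,z_\ell)^\top$, and let $I_{\tau_H}$ be the ideal of $k[z]$ generated by the $2\times2$ minors of the $\ell\times 2$ matrix $[\,T_Hz\;\;z\,]$. Then $I_{\tau_H}$ equals the ideal of $k[z]$ generated by the $2\times 2$ minors of the $m\times 2$ matrix $[\,RT_1B_Hz\;\;T_2B_Hz\,]$. -}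

module Defs where

open import Level using (Level; _⊔_) renaming (suc to lsuc)
open import Algebra.Bundles using (CommutativeRing)
open import Data.Nat using (ℕ) renaming (zero to nzero; suc to nsuc)
open import Data.Fin using (Fin; zero; suc; _<_)
open import Data.Product using (Σ; ∃; _×_; _,_)
open import Function using (_∘_)
open import Relation.Nullary using (¬_)
open import Relation.Binary.PropositionalEquality using (_≡_)

record Field (c ℓ : Level) : Set (lsuc (c ⊔ ℓ)) where
  field
    commutativeRing : CommutativeRing c ℓ
  open CommutativeRing commutativeRing public
  field
    0≉1     : ¬ (0# ≈ 1#)
    inverse : ∀ x → ¬ (x ≈ 0#) → ∃ λ y → (x * y) ≈ 1#

module Over {c ℓ : Level} (F : Field c ℓ) where
  open Field F using (Carrier; _≈_; _+_; _*_; -_; 0#; 1#)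

  Infinite : Set (c ⊔ ℓ)
  Infinite = Σ (ℕ → Carrier) λ f → ∀ i j → f i ≈ f j → i ≡ j

  Vect : ℕ → Set c
  Vect n = Fin n → Carrier

  Mat : ℕ → ℕ → Set c
  Mat m n = Fin m → Fin n → Carrier

  sumₖ : ∀ n → (Fin n → Carrier) → Carrier
  sumₖ nzero    f = 0#
  sumₖ (nsuc n) f = f zero + sumₖ n (f ∘ suc)

  _·_ : ∀ {m n} → Mat m n → Vect n → Vect m
  _·_ {n = n} A v i = sumₖ n (λ j → A i j * v j)

  _⊗_ : ∀ {m n p} → Mat m n → Mat n p → Mat m p
  _⊗_ {n = n} A C i j = sumₖ n (λ r → A i r * C r j)

  _≈ᵥ_ : ∀ {n} → Vect n → Vect n → Set ℓ
  u ≈ᵥ v = ∀ i → u i ≈ v i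

  0ᵥ : ∀ {n} → Vect n
  0ᵥ _ = 0#

  InIm : ∀ {m n} → Mat m n → Vect m → Set (c ⊔ ℓ)
  InIm A x = ∃ λ y → (A · y) ≈ᵥ x

  IndepCols : ∀ {m n} → Mat m n → Set (c ⊔ ℓ)
  IndepCols B = ∀ z → (B · z) ≈ᵥ 0ᵥ → z ≈ᵥ 0ᵥ

  Idempotent : ∀ {m} → Mat m m → Set (c ⊔ ℓ)
  Idempotent R = ∀ x → (R · (R · x)) ≈ᵥ (R · x)

  SameImage : ∀ {m n p} → Mat m n → Mat m p → Set (c ⊔ ℓ)
  SameImage A C = ∀ x → (InIm A x → InIm C x) × (InIm C x → InIm A x)

  DimImage : ∀ {m n} → Mat m n → ℕ → Set (c ⊔ ℓ)
  DimImage {m} A d = Σ (Mat m d) λ C → IndepCols C × SameImage A C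

  -- The polynomial ring k[z_1,…,z_n]: the free commutative k-algebra on
  -- n generators, i.e. polynomial expressions modulo the congruence
  -- generated by the commutative-ring axioms and the ring structure of k.

  infixl 6 _⊕_
  infixl 7 _⊛_
  data Poly (n : ℕ) : Set c where
    con : Carrier → Poly n
    var : Fin n → Poly n
    _⊕_ : Poly n → Poly n → Poly n
    _⊛_ : Poly n → Poly n → Poly n
    ⊝_  : Poly n → Poly n

  infix 4 _≃_
  data _≃_ {n : ℕ} : Poly n → Poly n → Set (c ⊔ ℓ) where
    ≃-refl  : ∀ {p} → p ≃ p
    ≃-sym   : ∀ {p q} → p ≃ q → q ≃ p
    ≃-trans : ∀ {p q r} → p ≃ q → q ≃ r → p ≃ r
    ⊕-cong  : ∀ {p p′ q q′} → p ≃ p′ → q ≃ q′ → p ⊕ q ≃ p′ ⊕ q′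
    ⊛-cong  : ∀ {p p′ q q′} → p ≃ p′ → q ≃ q′ → p ⊛ q ≃ p′ ⊛ q′
    ⊝-cong  : ∀ {p p′} → p ≃ p′ → ⊝ p ≃ ⊝ p′
    ⊕-assoc : ∀ p q r → (p ⊕ q) ⊕ r ≃ p ⊕ (q ⊕ r)
    ⊕-comm  : ∀ p q → p ⊕ q ≃ q ⊕ p
    ⊕-idʳ   : ∀ p → p ⊕ con 0# ≃ p
    ⊕-invʳ  : ∀ p → p ⊕ (⊝ p) ≃ con 0#
    ⊛-assoc : ∀ p q r → (p ⊛ q) ⊛ r ≃ p ⊛ (q ⊛ r)
    ⊛-comm  : ∀ p q → p ⊛ q ≃ q ⊛ p
    ⊛-idʳ   : ∀ p → p ⊛ con 1# ≃ p
    distribˡ : ∀ p q r → p ⊛ (q ⊕ r) ≃ (p ⊛ q) ⊕ (p ⊛ r)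
    con-cong : ∀ {a b} → a ≈ b → con a ≃ con b
    con-+   : ∀ a b → con (a + b) ≃ con a ⊕ con b
    con-*   : ∀ a b → con (a * b) ≃ con a ⊛ con b
    con-neg : ∀ a → con (- a) ≃ ⊝ con a

  sumₚ : ∀ {n} k → (Fin k → Poly n) → Poly n
  sumₚ nzero    f = con 0#
  sumₚ (nsuc k) f = f zero ⊕ sumₚ k (f ∘ suc)

  _∈⟨_⟩ : ∀ {n} {I : Set c} → Poly n → (I → Poly n) → Set (c ⊔ ℓ)
  _∈⟨_⟩ {n} {I} p g =
    Σ ℕ λ r → Σ (Fin r → I) λ idx → Σ (Fin r → Poly n) λ coeff →
      p ≃ sumₚ r (λ s → coeff s ⊛ g (idx s))

  SameIdeal : ∀ {n} {I J : Set c} → (I → Poly n) → (J → Poly n) → Set (c ⊔ ℓ)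
  SameIdeal g h = ∀ p → (p ∈⟨ g ⟩ → p ∈⟨ h ⟩) × (p ∈⟨ h ⟩ → p ∈⟨ g ⟩)

  zvec : ∀ {n} → Fin n → Poly n
  zvec = var

  _·ₚ_ : ∀ {m n k} → Mat m n → (Fin n → Poly k) → (Fin m → Poly k)
  _·ₚ_ {n = n} A v i = sumₚ n (λ j → con (A i j) ⊛ v j)

  -- index set of 2×2 minors of an r×2 matrix: pairs of rows i < j
  RowPair : ℕ → Set c
  RowPair r = Level.Lift c (Σ (Fin r × Fin r) λ { (i , j) → i < j })

  minors : ∀ {r n} → (Fin r → Poly n) → (Fin r → Poly n) → RowPair r → Poly n
  minors a b (Level.lift ((i , j) , _)) = (a i ⊛ b j) ⊕ (⊝ (a j ⊛ b i))

module Submission where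

-- Write M = T₂B for the matrix of τ₂ restricted to H. The hypothesis on T says RT₁B = MT, so
-- [RT₁Bz  T₂Bz] = M [Tz  z], and by the Cauchy–Binet formula for 2×2 minors every minor of the
-- left-hand side is a k-linear combination of minors of [Tz  z]. Conversely τ₂ is injective on H,
-- so M has a left inverse L and [Tz  z] = L [RT₁Bz  T₂Bz], which gives the other inclusion.
-- Equality in k is not decidable, so L is built from cofactors: ρ yields a left inverse H′ of a
-- basis of im τ₂, the square matrix H′M is injective, and an injective square matrix has a nonzero
-- determinant (a pivoting argument, carried out under a double negation).

module Submission where

open import Level using (Level; _⊔_; lift)
open import Algebra.Bundles using (CommutativeRing)
open import Data.Nat using (ℕ; zero; suc; s≤s; z≤n)
open import Data.Fin using (Fin; zero; suc; punchIn; punchOut; _<_; _≟_)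
open import Data.Fin.Properties using (punchInᵢ≢i; punchIn-punchOut; <-cmp)
open import Data.Vec.Functional using (updateAt; insertAt; _∷_)
open import Data.Vec.Functional.Properties using (updateAt-updates; insertAt-lookup; insertAt-punchIn)
open import Data.Product using (Σ; _,_; proj₁; proj₂)
open import Data.Empty using (⊥-elim)
open import Function using (_∘_; flip)
open import Relation.Nullary using (¬_; Dec; yes; no)
open import Relation.Binary.Definitions using (tri<; tri≈; tri>)
open import Relation.Binary.PropositionalEquality as ≡ using (_≡_; _≢_)

open import Defs

¬¬-∀-Fin : ∀ {p} n {P : Fin n → Set p} → (∀ i → ¬ ¬ P i) → ¬ ¬ (∀ i → P i)
¬¬-∀-Fin zero    _   ¬∀P = ¬∀P (λ ())
¬¬-∀-Fin (suc n) ¬¬P ¬∀P = ¬¬P zero λ P₀ → ¬¬-∀-Fin n (¬¬P ∘ suc) λ P₊ → ¬∀P λ { zero → P₀ ; (suc i) → P₊ i }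

module Determinant {c ℓ} (R : CommutativeRing c ℓ) where

  open CommutativeRing R hiding (zero)
  open import Algebra.Properties.Ring ring
    using (-‿distribˡ-*; -‿distribʳ-*; -‿involutive; -0#≈0#; -‿+-comm; x[y-z]≈xy-xz; [y-z]x≈yx-zx; ⁻¹-anti-homo‿-; x≈y⇒x∙y⁻¹≈ε)
  open import Algebra.Properties.Semiring.Sum semiring public
  open import Algebra.Properties.CommutativeSemigroup *-commutativeSemigroup using (x∙yz≈y∙xz; xy∙z≈xz∙y)
  open import Algebra.Properties.CommutativeSemigroup +-commutativeSemigroup using ()
    renaming (interchange to +-interchange)
  import Algebra.Solver.CommutativeMonoid *-commutativeMonoid as *-Solver
  import Algebra.Solver.CommutativeMonoid +-commutativeMonoid as +-Solver
  open import Relation.Binary.Reasoning.Setoid setoid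

  sum-zero : ∀ {n} {f : Fin n → Carrier} → (∀ i → f i ≈ 0#) → sum f ≈ 0#
  sum-zero {n} f≈0 = trans (sum-cong-≋ f≈0) (sum-replicate-zero n)

  -‿distrib-sum : ∀ {n} (f : Fin n → Carrier) → - sum f ≈ ∑[ i < n ] (- f i)
  -‿distrib-sum {zero}  f = -0#≈0#
  -‿distrib-sum {suc n} f = trans (sym (-‿+-comm _ _)) (+-congˡ (-‿distrib-sum (f ∘ suc)))

  sum-single : ∀ {n} (f : Fin n → Carrier) i → (∀ j → j ≢ i → f j ≈ 0#) → sum f ≈ f i
  sum-single {suc n} f i f≈0 = begin
    sum f                      ≈⟨ sum-remove {i = i} f ⟩
    f i + ∑[ t < n ] f (punchIn i t) ≈⟨ +-congˡ (sum-zero (λ t → f≈0 _ (punchInᵢ≢i i t))) ⟩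
    f i + 0#                   ≈⟨ +-identityʳ _ ⟩
    f i                        ∎

  δ : ∀ {n} → Fin n → Fin n → Carrier
  δ zero    zero    = 1#
  δ zero    (suc _) = 0#
  δ (suc _) zero    = 0#
  δ (suc i) (suc j) = δ i j

  δ-diag : ∀ {n} (i : Fin n) → δ i i ≈ 1#
  δ-diag zero    = refl
  δ-diag (suc i) = δ-diag i

  δ-≢ : ∀ {n} {i j : Fin n} → i ≢ j → δ i j ≈ 0#
  δ-≢ {i = zero}  {zero}  i≢j = ⊥-elim (i≢j ≡.refl)
  δ-≢ {i = zero}  {suc j} i≢j = refl
  δ-≢ {i = suc i} {zero}  i≢j = refl
  δ-≢ {i = suc i} {suc j} i≢j = δ-≢ (i≢j ∘ ≡.cong suc)

  sum-*δ : ∀ {n} (f : Fin n → Carrier) i → ∑[ j < n ] (f j * δ j i) ≈ f i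
  sum-*δ f i = begin
    ∑[ j < _ ] (f j * δ j i) ≈⟨ sum-single _ i (λ j j≢i → trans (*-congˡ (δ-≢ j≢i)) (zeroʳ _)) ⟩
    f i * δ i i            ≈⟨ trans (*-congˡ (δ-diag i)) (*-identityʳ _) ⟩
    f i                    ∎

  -x*-y≈x*y : ∀ x y → - x * - y ≈ x * y
  -x*-y≈x*y x y = trans (sym (-‿distribˡ-* x (- y))) (trans (-‿cong (sym (-‿distribʳ-* x y))) (-‿involutive _))

  [ab][[cd]e]≈[ac][[bd]e] : ∀ a b c d e → (a * b) * ((c * d) * e) ≈ (a * c) * ((b * d) * e)
  [ab][[cd]e]≈[ac][[bd]e] = solve 5 (λ a b c d e → (a ⊕ b) ⊕ ((c ⊕ d) ⊕ e) ⊜ (a ⊕ c) ⊕ ((b ⊕ d) ⊕ e)) refl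
    where open *-Solver

  sign : ∀ {n} → Fin n → Carrier
  sign zero    = 1#
  sign (suc i) = - sign i

  sign*sign≈1 : ∀ {n} (i : Fin n) → sign i * sign i ≈ 1#
  sign*sign≈1 zero    = *-identityˡ 1#
  sign*sign≈1 (suc i) = trans (-x*-y≈x*y _ _) (sign*sign≈1 i)

  Square : ℕ → Set c
  Square n = Fin n → Fin n → Carrier

  minor : ∀ {n} → Square (suc n) → Fin (suc n) → Square n
  minor X i a b = X (punchIn i a) (suc b)

  det : ∀ {n} → Square n → Carrier
  det {zero}  X = 1#
  det {suc n} X = ∑[ i < suc n ] ((sign i * X i zero) * det (minor X i))

  det-cong : ∀ {n} {X Y : Square n} → (∀ a b → X a b ≈ Y a b) → det X ≈ det Y
  det-cong {zero}  X≈Y = refl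
  det-cong {suc n} X≈Y =
    sum-cong-≋ (λ i → *-cong (*-congˡ {sign i} (X≈Y i zero)) (det-cong (λ a b → X≈Y (punchIn i a) (suc b))))

  pairSum : ∀ {n} → (Fin n → Fin n → Carrier) → Carrier
  pairSum {zero}  G = 0#
  pairSum {suc n} G = ∑[ t < n ] G zero (suc t) + pairSum (λ i j → G (suc i) (suc j))

  pairSum-cong : ∀ {n} {G H : Fin n → Fin n → Carrier} →
                 (∀ i j → i < j → G i j ≈ H i j) → pairSum G ≈ pairSum H
  pairSum-cong {zero}  G≈H = refl
  pairSum-cong {suc n} G≈H = +-cong (sum-cong-≋ (λ t → G≈H zero (suc t) (s≤s z≤n)))
                                    (pairSum-cong (λ i j i<j → G≈H (suc i) (suc j) (s≤s i<j)))

  pairSum-zero : ∀ {n} {G : Fin n → Fin n → Carrier} → (∀ i j → i < j → G i j ≈ 0#) → pairSum G ≈ 0#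
  pairSum-zero {zero}  G≈0 = refl
  pairSum-zero {suc n} G≈0 = trans (+-cong (sum-zero (λ t → G≈0 zero (suc t) (s≤s z≤n)))
                                           (pairSum-zero (λ i j i<j → G≈0 (suc i) (suc j) (s≤s i<j))))
                                   (+-identityʳ 0#)

  pairSum-distrib-+ : ∀ {n} (G H : Fin n → Fin n → Carrier) →
                      pairSum (λ i j → G i j + H i j) ≈ pairSum G + pairSum H
  pairSum-distrib-+ {zero}  G H = sym (+-identityʳ 0#)
  pairSum-distrib-+ {suc n} G H =
    trans (+-cong (∑-distrib-+ (λ t → G zero (suc t)) (λ t → H zero (suc t))) (pairSum-distrib-+ G′ H′))
          (+-interchange _ _ _ _)
    where
    G′ H′ : Fin n → Fin n → Carrier
    G′ i j = G (suc i) (suc j)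
    H′ i j = H (suc i) (suc j)

  -‿distrib-pairSum : ∀ {n} (G : Fin n → Fin n → Carrier) → - pairSum G ≈ pairSum (λ i j → - G i j)
  -‿distrib-pairSum {zero}  G = -0#≈0#
  -‿distrib-pairSum {suc n} G =
    trans (sym (-‿+-comm _ _))
          (+-cong (-‿distrib-sum (λ t → G zero (suc t))) (-‿distrib-pairSum (λ i j → G (suc i) (suc j))))

  sum-offDiagonal : ∀ {n} (G : Fin (suc n) → Fin (suc n) → Carrier) →
                    ∑[ i < suc n ] ∑[ t < n ] G i (punchIn i t) ≈ pairSum G + pairSum (flip G)
  sum-offDiagonal {zero}  G = sym (trans (+-congˡ (+-identityʳ 0#)) (+-identityʳ _))
  sum-offDiagonal {suc n} G = begin
    A + ∑[ i < suc n ] (G (suc i) zero + ∑[ t < n ] G′ i (punchIn i t))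
      ≈⟨ +-congˡ (∑-distrib-+ (λ i → G (suc i) zero) (λ i → ∑[ t < n ] G′ i (punchIn i t))) ⟩
    A + (B + ∑[ i < suc n ] ∑[ t < n ] G′ i (punchIn i t))
      ≈⟨ +-congˡ (+-congˡ (sum-offDiagonal G′)) ⟩
    A + (B + (pairSum G′ + pairSum (flip G′)))
      ≈⟨ +-Solver.solve 4 (λ a b c d → a ⊕ (b ⊕ (c ⊕ d)) ⊜ (a ⊕ c) ⊕ (b ⊕ d)) refl A B _ _ ⟩
    (A + pairSum G′) + (B + pairSum (flip G′)) ∎
    where
    open +-Solver using (_⊕_; _⊜_)
    A = ∑[ t < suc n ] G zero (suc t)
    B = ∑[ i < suc n ] G (suc i) zero
    G′ : Fin (suc n) → Fin (suc n) → Carrier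
    G′ i j = G (suc i) (suc j)

  -- punchOut without the proof of i ≢ j; junk value on the diagonal.
  punchOut′ : ∀ {n} → Fin (suc (suc n)) → Fin (suc (suc n)) → Fin (suc n)
  punchOut′         zero    zero    = zero
  punchOut′         zero    (suc j) = j
  punchOut′         (suc i) zero    = zero
  punchOut′ {zero}  (suc i) (suc j) = zero
  punchOut′ {suc n} (suc i) (suc j) = suc (punchOut′ i j)

  punchOut′-punchIn : ∀ {n} (i : Fin (suc (suc n))) t → punchOut′ i (punchIn i t) ≡ t
  punchOut′-punchIn         zero    t       = ≡.refl
  punchOut′-punchIn         (suc i) zero    = ≡.refl
  punchOut′-punchIn {zero}  (suc i) (suc ())
  punchOut′-punchIn {suc n} (suc i) (suc t) = ≡.cong suc (punchOut′-punchIn i t)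

  otherRows : ∀ {n} → Fin (suc (suc n)) → Fin (suc (suc n)) → Fin n → Fin (suc (suc n))
  otherRows i j a = punchIn i (punchIn (punchOut′ i j) a)

  otherRows-sym : ∀ {n} {i j : Fin (suc (suc n))} → i < j → ∀ a → otherRows j i a ≡ otherRows i j a
  otherRows-sym {i = zero}          {suc j} _         a       = ≡.refl
  otherRows-sym {zero}  {suc zero}  {suc zero} (s≤s ()) a
  otherRows-sym {suc n} {suc i}     {suc j} _         zero    = ≡.refl
  otherRows-sym {suc n} {suc i}     {suc j} (s≤s i<j) (suc a) = ≡.cong suc (otherRows-sym i<j a)

  sign₂ : ∀ {n} → Fin (suc (suc n)) → Fin (suc (suc n)) → Carrier
  sign₂ i j = sign i * sign (punchOut′ i j)

  sign₂-anti : ∀ {n} {i j : Fin (suc (suc n))} → i < j → sign₂ j i ≈ - sign₂ i j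
  sign₂-anti {i = zero}          {suc j}    _         = trans (*-identityʳ _) (-‿cong (sym (*-identityˡ _)))
  sign₂-anti {zero}  {suc zero}  {suc zero} (s≤s ())
  sign₂-anti {suc n} {suc i}     {suc j}    (s≤s i<j) =
    trans (-x*-y≈x*y _ _) (trans (sign₂-anti i<j) (-‿cong (sym (-x*-y≈x*y _ _))))

  complement₂ : ∀ {n} → Square (suc (suc n)) → Fin (suc (suc n)) → Fin (suc (suc n)) → Carrier
  complement₂ X i j = det (λ a b → X (otherRows i j a) (suc (suc b)))

  minor₂ : ∀ {n} → Square (suc (suc n)) → Fin (suc (suc n)) → Fin (suc (suc n)) → Carrier
  minor₂ X i j = X i zero * X j (suc zero) - X j zero * X i (suc zero)

  det-expand₂ : ∀ {n} (X : Square (suc (suc n))) →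
                det X ≈ pairSum (λ i j → sign₂ i j * (minor₂ X i j * complement₂ X i j))
  det-expand₂ {n} X = begin
    det X                                                ≈⟨ det≈sum-offDiagonal ⟩
    ∑[ i < suc (suc n) ] ∑[ t < suc n ] H i (punchIn i t) ≈⟨ sum-offDiagonal H ⟩
    pairSum H + pairSum (flip H)                         ≈⟨ sym (pairSum-distrib-+ H (flip H)) ⟩
    pairSum (λ i j → H i j + H j i)                      ≈⟨ pairSum-cong pairTerm ⟩
    pairSum (λ i j → sign₂ i j * (minor₂ X i j * complement₂ X i j)) ∎
    where
    term : (i j : Fin (suc (suc n))) → Fin (suc n) → Carrier
    term i j t = (sign i * sign t) * ((X i zero * X j (suc zero)) *
                   det (λ a b → X (punchIn i (punchIn t a)) (suc (suc b))))
    H : Fin (suc (suc n)) → Fin (suc (suc n)) → Carrier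
    H i j = term i j (punchOut′ i j)
    det≈sum-offDiagonal : det X ≈ ∑[ i < suc (suc n) ] ∑[ t < suc n ] H i (punchIn i t)
    det≈sum-offDiagonal = sum-cong-≋ λ i → begin
      (sign i * X i zero) * ∑[ t < suc n ] ((sign t * X (punchIn i t) (suc zero)) * det (minor (minor X i) t))
        ≈⟨ *-distribˡ-sum _ (λ t → (sign t * X (punchIn i t) (suc zero)) * det (minor (minor X i) t)) ⟩
      ∑[ t < suc n ] ((sign i * X i zero) * ((sign t * X (punchIn i t) (suc zero)) * det (minor (minor X i) t)))
        ≈⟨ sum-cong-≋ {suc n} (λ t → [ab][[cd]e]≈[ac][[bd]e] (sign i) (X i zero) (sign t)
                                                (X (punchIn i t) (suc zero)) (det (minor (minor X i) t))) ⟩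
      ∑[ t < suc n ] term i (punchIn i t) t
        ≡⟨ sum-cong-≗ (λ t → ≡.cong (term i (punchIn i t)) (≡.sym (punchOut′-punchIn i t))) ⟩
      ∑[ t < suc n ] H i (punchIn i t) ∎
    pairTerm : ∀ i j → i < j → H i j + H j i ≈ sign₂ i j * (minor₂ X i j * complement₂ X i j)
    pairTerm i j i<j = begin
      σ * (a * Δ) + sign₂ j i * (b * complement₂ X j i)
        ≈⟨ +-congˡ (*-cong (sign₂-anti i<j) (*-congˡ (det-cong (λ a b → reflexive
             (≡.cong (λ r → X r (suc (suc b))) (otherRows-sym i<j a)))))) ⟩
      σ * (a * Δ) + - σ * (b * Δ)  ≈⟨ +-congˡ (sym (-‿distribˡ-* _ _)) ⟩
      σ * (a * Δ) - σ * (b * Δ)    ≈⟨ sym (x[y-z]≈xy-xz σ _ _) ⟩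
      σ * (a * Δ - b * Δ)          ≈⟨ *-congˡ (sym ([y-z]x≈yx-zx Δ a b)) ⟩
      σ * ((a - b) * Δ)            ∎
      where
      σ = sign₂ i j
      a = X i zero * X j (suc zero)
      b = X j zero * X i (suc zero)
      Δ = complement₂ X i j

  det-cols01-equal : ∀ {n} (X : Square (suc (suc n))) → (∀ r → X r zero ≈ X r (suc zero)) → det X ≈ 0#
  det-cols01-equal X col₀≈col₁ = trans (det-expand₂ X) (pairSum-zero λ i j _ → begin
    sign₂ i j * (minor₂ X i j * complement₂ X i j) ≈⟨ *-congˡ (*-congʳ (minor₂≈0 i j)) ⟩
    sign₂ i j * (0# * complement₂ X i j)           ≈⟨ trans (*-congˡ (zeroˡ _)) (zeroʳ _) ⟩
    0#                                             ∎)
    where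
    minor₂≈0 : ∀ i j → minor₂ X i j ≈ 0#
    minor₂≈0 i j = x≈y⇒x∙y⁻¹≈ε (trans (*-cong (col₀≈col₁ i) (sym (col₀≈col₁ j))) (*-comm _ _))

  swap01 : ∀ {n} → Fin (suc (suc n)) → Fin (suc (suc n))
  swap01 zero          = suc zero
  swap01 (suc zero)    = zero
  swap01 (suc (suc b)) = suc (suc b)

  det-swap01 : ∀ {n} (X : Square (suc (suc n))) → det (λ r c → X r (swap01 c)) ≈ - det X
  det-swap01 X = begin
    det X′                                  ≈⟨ det-expand₂ X′ ⟩
    pairSum (term X′)                       ≈⟨ pairSum-cong (λ i j _ → term-swap i j) ⟩
    pairSum (λ i j → - term X i j)          ≈⟨ -‿distrib-pairSum (term X) ⟨
    - pairSum (term X)                      ≈⟨ -‿cong (det-expand₂ X) ⟨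
    - det X                                 ∎
    where
    X′ = λ r c → X r (swap01 c)
    term : Square _ → Fin _ → Fin _ → Carrier
    term Y i j = sign₂ i j * (minor₂ Y i j * complement₂ Y i j)
    minor₂-swap : ∀ i j → minor₂ X′ i j ≈ - minor₂ X i j
    minor₂-swap i j = sym (trans (⁻¹-anti-homo‿- _ _) (+-cong (*-comm _ _) (-‿cong (*-comm _ _))))
    term-swap : ∀ i j → term X′ i j ≈ - term X i j
    term-swap i j = begin
      sign₂ i j * (minor₂ X′ i j * complement₂ X i j)   ≈⟨ *-congˡ (*-congʳ (minor₂-swap i j)) ⟩
      sign₂ i j * (- minor₂ X i j * complement₂ X i j)  ≈⟨ *-congˡ (sym (-‿distribˡ-* _ _)) ⟩
      sign₂ i j * - (minor₂ X i j * complement₂ X i j)  ≈⟨ sym (-‿distribʳ-* _ _) ⟩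
      - term X i j                                      ∎

  det-alternating : ∀ {n} (X : Square n) {a b : Fin n} → a ≢ b → (∀ r → X r a ≈ X r b) → det X ≈ 0#

  det-cols-suc-equal : ∀ {n} (X : Square (suc n)) {a b : Fin n} → a ≢ b →
                       (∀ r → X r (suc a) ≈ X r (suc b)) → det X ≈ 0#
  det-cols-suc-equal X a≢b eq = sum-zero λ i →
    trans (*-congˡ {sign i * X i zero} (det-alternating (minor X i) a≢b (eq ∘ punchIn i))) (zeroʳ _)

  det-col₀-equal : ∀ {n} (X : Square (suc n)) b → (∀ r → X r zero ≈ X r (suc b)) → det X ≈ 0#
  det-col₀-equal X zero    eq = det-cols01-equal X eq
  det-col₀-equal X (suc b) eq = begin
    det X                          ≈⟨ sym (-‿involutive _) ⟩
    - - det X                      ≈⟨ -‿cong (sym (det-swap01 X)) ⟩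
    - det (λ r c → X r (swap01 c)) ≈⟨ -‿cong (det-cols-suc-equal (λ r c → X r (swap01 c)) {zero} {suc b} (λ ()) eq) ⟩
    - 0#                           ≈⟨ -0#≈0# ⟩
    0#                             ∎

  det-alternating X {zero}  {zero}  0≢0 _  = ⊥-elim (0≢0 ≡.refl)
  det-alternating X {zero}  {suc b} _   eq = det-col₀-equal X b eq
  det-alternating X {suc a} {zero}  _   eq = det-col₀-equal X a (sym ∘ eq)
  det-alternating X {suc a} {suc b} a≢b eq = det-cols-suc-equal X (a≢b ∘ ≡.cong suc) eq

  det-zeroRow : ∀ {n} (X : Square n) q → (∀ b → X q b ≈ 0#) → det X ≈ 0#
  det-zeroRow {suc n} X q row≈0 = sum-zero term≈0
    where
    term≈0 : ∀ i → (sign i * X i zero) * det (minor X i) ≈ 0#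
    term≈0 i with i ≟ q
    ... | yes ≡.refl = trans (*-congʳ (trans (*-congˡ (row≈0 zero)) (zeroʳ _))) (zeroˡ _)
    ... | no i≢q     = trans (*-congˡ (det-zeroRow (minor X i) (punchOut i≢q) minorRow≈0)) (zeroʳ _)
      where
      minorRow≈0 : ∀ b → minor X i (punchOut i≢q) b ≈ 0#
      minorRow≈0 b = trans (reflexive (≡.cong (λ r → X r (suc b)) (punchIn-punchOut i≢q))) (row≈0 (suc b))

  replaceColumn : ∀ {n} → Square n → Fin n → (Fin n → Carrier) → Square n
  replaceColumn X k u r = updateAt (X r) k (λ _ → u r)

  ∑-+-scaled : ∀ {n} (a b e : Fin n → Carrier) x →
               ∑[ r < n ] ((a r + x * b r) * e r) ≈ ∑[ r < n ] (a r * e r) + x * ∑[ r < n ] (b r * e r)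
  ∑-+-scaled {n} a b e x = begin
    ∑[ r < n ] ((a r + x * b r) * e r)
      ≈⟨ sum-cong-≋ {n} (λ r → trans (distribʳ (e r) (a r) (x * b r)) (+-congˡ (*-assoc x (b r) (e r)))) ⟩
    ∑[ r < n ] (a r * e r + x * (b r * e r))      ≈⟨ ∑-distrib-+ (λ r → a r * e r) (λ r → x * (b r * e r)) ⟩
    ∑[ r < n ] (a r * e r) + ∑[ r < n ] (x * (b r * e r)) ≈⟨ +-congˡ (sym (*-distribˡ-sum x (λ r → b r * e r))) ⟩
    ∑[ r < n ] (a r * e r) + x * ∑[ r < n ] (b r * e r) ∎

  ∑-*-∑-comm : ∀ {m n} (a : Fin m → Carrier) (b : Fin n → Carrier) (e : Fin m → Fin n → Carrier) →
               ∑[ r < m ] (a r * ∑[ k < n ] (b k * e r k)) ≈ ∑[ k < n ] (b k * ∑[ r < m ] (a r * e r k))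
  ∑-*-∑-comm {m} {n} a b e = begin
    ∑[ r < m ] (a r * ∑[ k < n ] (b k * e r k))
      ≈⟨ sum-cong-≋ {m} (λ r → trans (*-distribˡ-sum (a r) (λ k → b k * e r k))
                                     (sum-cong-≋ {n} (λ k → x∙yz≈y∙xz (a r) (b k) (e r k)))) ⟩
    ∑[ r < m ] ∑[ k < n ] (b k * (a r * e r k)) ≈⟨ ∑-comm (λ r k → b k * (a r * e r k)) ⟩
    ∑[ k < n ] ∑[ r < m ] (b k * (a r * e r k))
      ≈⟨ sum-cong-≋ {n} (λ k → sym (*-distribˡ-sum (b k) (λ r → a r * e r k))) ⟩
    ∑[ k < n ] (b k * ∑[ r < m ] (a r * e r k)) ∎

  det-+-outer : ∀ {n} (Y : Square n) (u l : Fin n → Carrier) →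
                det (λ r c → Y r c + u r * l c) ≈ det Y + ∑[ k < n ] (l k * det (replaceColumn Y k u))
  det-+-outer {zero}  Y u l = sym (+-identityʳ 1#)
  det-+-outer {suc n} Y u l = begin
    ∑[ r < suc n ] ((sign r * (Y r zero + u r * l zero)) * det (minor Y′ r))
      ≈⟨ sum-cong-≋ {suc n} (λ r → *-cong (row-term r) (det-+-outer (minor Y r) (u ∘ punchIn r) (l ∘ suc))) ⟩
    ∑[ r < suc n ] ((a r + l zero * b r) * (d r + S r))
      ≈⟨ sum-cong-≋ {suc n} (λ r → distribˡ (a r + l zero * b r) (d r) (S r)) ⟩
    ∑[ r < suc n ] ((a r + l zero * b r) * d r + (a r + l zero * b r) * S r)
      ≈⟨ ∑-distrib-+ (λ r → (a r + l zero * b r) * d r) (λ r → (a r + l zero * b r) * S r) ⟩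
    ∑[ r < suc n ] ((a r + l zero * b r) * d r) + ∑[ r < suc n ] ((a r + l zero * b r) * S r)
      ≈⟨ +-cong (∑-+-scaled a b d (l zero)) (∑-*-∑-comm (λ r → a r + l zero * b r) (l ∘ suc) e) ⟩
    (det Y + l zero * det (replaceColumn Y zero u)) +
      ∑[ k < n ] (l (suc k) * ∑[ r < suc n ] ((a r + l zero * b r) * e r k))
      ≈⟨ +-congˡ (sum-cong-≋ {n} (λ k → *-congˡ (column-term k))) ⟩
    (det Y + l zero * det (replaceColumn Y zero u)) + ∑[ k < n ] (l (suc k) * det (replaceColumn Y (suc k) u))
      ≈⟨ +-assoc _ _ _ ⟩
    det Y + ∑[ k < suc n ] (l k * det (replaceColumn Y k u)) ∎
    where
    Y′ : Square (suc n)
    Y′ r c = Y r c + u r * l c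
    a b d S : Fin (suc n) → Carrier
    a r = sign r * Y r zero
    b r = sign r * u r
    d r = det (minor Y r)
    e : Fin (suc n) → Fin n → Carrier
    e r k = det (replaceColumn (minor Y r) k (u ∘ punchIn r))
    S r = ∑[ k < n ] (l (suc k) * e r k)
    row-term : ∀ r → sign r * (Y r zero + u r * l zero) ≈ a r + l zero * b r
    row-term r = trans (distribˡ _ _ _) (+-congˡ (trans (*-congˡ (*-comm _ _)) (x∙yz≈y∙xz _ _ _)))
    column-term : ∀ k → ∑[ r < suc n ] ((a r + l zero * b r) * e r k) ≈ det (replaceColumn Y (suc k) u)
    -- ∑ a·e and ∑ b·e are the first-column expansions of Y with column suc k replaced by u,
    -- and of that matrix with column 0 replaced by u as well.
    column-term k = begin
      ∑[ r < suc n ] ((a r + l zero * b r) * e r k)           ≈⟨ ∑-+-scaled a b (λ r → e r k) (l zero) ⟩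
      det (replaceColumn Y (suc k) u) + l zero * det Y″         ≈⟨ +-congˡ (*-congˡ det-Y″≈0) ⟩
      det (replaceColumn Y (suc k) u) + l zero * 0#             ≈⟨ trans (+-congˡ (zeroʳ _)) (+-identityʳ _) ⟩
      det (replaceColumn Y (suc k) u) ∎
      where
      Y″ = replaceColumn (replaceColumn Y (suc k) u) zero u
      det-Y″≈0 : det Y″ ≈ 0#
      det-Y″≈0 = det-alternating Y″ {zero} {suc k} (λ ())
                   (λ r → sym (reflexive (updateAt-updates k (λ b → Y r (suc b)))))

  cofactor : ∀ {n} → Square (suc n) → Fin (suc n) → Carrier
  cofactor X r = sign r * det (minor X r)

  ∑-cofactor*col₀ : ∀ {n} (X : Square (suc n)) → ∑[ r < suc n ] (cofactor X r * X r zero) ≈ det X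
  ∑-cofactor*col₀ {n} X = sum-cong-≋ {suc n} λ r → xy∙z≈xz∙y (sign r) (det (minor X r)) (X r zero)

  ∑-cofactor*col-suc : ∀ {n} (X : Square (suc n)) k → ∑[ r < suc n ] (cofactor X r * X r (suc k)) ≈ 0#
  ∑-cofactor*col-suc X k = trans (∑-cofactor*col₀ X′) (det-alternating X′ {zero} {suc k} (λ ()) (λ _ → refl))
    where X′ = replaceColumn X zero (λ r → X r (suc k))

module Matrix {c ℓ} (F : Field c ℓ) where

  open Field F hiding (zero)
  open Over F using (Vect; Mat; sumₖ; _·_; _⊗_; _≈ᵥ_; 0ᵥ; IndepCols; InIm; Idempotent; SameImage; DimImage)
  open Determinant commutativeRing public
  open import Algebra.Properties.Ring ring using (x[y-z]≈xy-xz; -‿distribʳ-*; x∙y⁻¹≈ε⇒x≈y)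
  open import Algebra.Properties.CommutativeSemigroup *-commutativeSemigroup using (xy∙z≈y∙xz)
  open import Algebra.Properties.CommutativeSemigroup +-commutativeSemigroup using ()
    renaming (xy∙z≈xz∙y to [x+y]+z≈[x+z]+y)
  open import Relation.Binary.Reasoning.Setoid setoid

  sumₖ≡sum : ∀ n (f : Fin n → Carrier) → sumₖ n f ≡ sum f
  sumₖ≡sum zero    f = ≡.refl
  sumₖ≡sum (suc n) f = ≡.cong (f zero +_) (sumₖ≡sum n (f ∘ suc))

  ·-sum : ∀ {m n} (A : Mat m n) v i → (A · v) i ≈ ∑[ j < n ] (A i j * v j)
  ·-sum {n = n} A v i = reflexive (sumₖ≡sum n _)

  ⊗-sum : ∀ {m n p} (A : Mat m n) (C : Mat n p) i j → (A ⊗ C) i j ≈ ∑[ r < n ] (A i r * C r j)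
  ⊗-sum {n = n} A C i j = reflexive (sumₖ≡sum n _)

  ·-congʳ : ∀ {m n} (A : Mat m n) {v w : Vect n} → v ≈ᵥ w → (A · v) ≈ᵥ (A · w)
  ·-congʳ {n = n} A v≈w i =
    trans (·-sum A _ i) (trans (sum-cong-≋ {n} (λ j → *-congˡ (v≈w j))) (sym (·-sum A _ i)))

  ·-congˡ : ∀ {m n} {A A′ : Mat m n} (v : Vect n) → (∀ i j → A i j ≈ A′ i j) → (A · v) ≈ᵥ (A′ · v)
  ·-congˡ {n = n} {A} {A′} v A≈A′ i =
    trans (·-sum A _ i) (trans (sum-cong-≋ {n} (λ j → *-congʳ (A≈A′ i j))) (sym (·-sum A′ _ i)))

  ⊗-· : ∀ {m n p} (A : Mat m n) (C : Mat n p) v → ((A ⊗ C) · v) ≈ᵥ (A · (C · v))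
  ⊗-· {m} {n} {p} A C v i = begin
    ((A ⊗ C) · v) i                                     ≈⟨ ·-sum (A ⊗ C) v i ⟩
    ∑[ j < p ] ((A ⊗ C) i j * v j)                      ≈⟨ sum-cong-≋ {p} (λ j → *-congʳ (⊗-sum A C i j)) ⟩
    ∑[ j < p ] (∑[ r < n ] (A i r * C r j) * v j)        ≈⟨ sum-cong-≋ {p} (λ j → *-distribʳ-sum (v j) (λ r → A i r * C r j)) ⟩
    ∑[ j < p ] ∑[ r < n ] ((A i r * C r j) * v j)        ≈⟨ ∑-comm (λ j r → (A i r * C r j) * v j) ⟩
    ∑[ r < n ] ∑[ j < p ] ((A i r * C r j) * v j)
      ≈⟨ sum-cong-≋ {n} (λ r → trans (sum-cong-≋ {p} (λ j → *-assoc _ _ _)) (sym (*-distribˡ-sum (A i r) (λ j → C r j * v j)))) ⟩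
    ∑[ r < n ] (A i r * ∑[ j < p ] (C r j * v j))        ≈⟨ sum-cong-≋ {n} (λ r → *-congˡ (sym (·-sum C v r))) ⟩
    ∑[ r < n ] (A i r * (C · v) r)                      ≈⟨ sym (·-sum A _ i) ⟩
    (A · (C · v)) i                                     ∎

  unit : ∀ {n} → Fin n → Vect n
  unit j k = δ k j

  ·-unit : ∀ {m n} (A : Mat m n) j i → (A · unit j) i ≈ A i j
  ·-unit A j i = trans (·-sum A _ i) (sum-*δ (A i) j)

  ·-0ᵥ : ∀ {m n} (A : Mat m n) → (A · 0ᵥ) ≈ᵥ 0ᵥ
  ·-0ᵥ {n = n} A i = trans (·-sum A _ i) (sum-zero {n} (λ j → zeroʳ _))

  ·-distrib-− : ∀ {m n} (A : Mat m n) (v w : Vect n) → (A · (λ k → v k - w k)) ≈ᵥ (λ i → (A · v) i - (A · w) i)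
  ·-distrib-− {n = n} A v w i = begin
    (A · (λ k → v k - w k)) i                          ≈⟨ ·-sum A _ i ⟩
    ∑[ k < n ] (A i k * (v k - w k))                   ≈⟨ sum-cong-≋ {n} (λ k → x[y-z]≈xy-xz (A i k) (v k) (w k)) ⟩
    ∑[ k < n ] (A i k * v k - A i k * w k)             ≈⟨ ∑-distrib-+ (λ k → A i k * v k) (λ k → - (A i k * w k)) ⟩
    ∑[ k < n ] (A i k * v k) + ∑[ k < n ] (- (A i k * w k))
      ≈⟨ +-congˡ (sym (-‿distrib-sum (λ k → A i k * w k))) ⟩
    ∑[ k < n ] (A i k * v k) - ∑[ k < n ] (A i k * w k) ≈⟨ sym (+-cong (·-sum A v i) (-‿cong (·-sum A w i))) ⟩
    (A · v) i - (A · w) i                              ∎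

  ·-ext : ∀ {m n} {A A′ : Mat m n} → (∀ v → (A · v) ≈ᵥ (A′ · v)) → ∀ i j → A i j ≈ A′ i j
  ·-ext {A = A} {A′} A≈A′ i j = trans (sym (·-unit A j i)) (trans (A≈A′ (unit j) i) (·-unit A′ j i))

  x*y≈0⇒y≈0 : ∀ {x y} → ¬ x ≈ 0# → x * y ≈ 0# → y ≈ 0#
  x*y≈0⇒y≈0 {x} {y} x≉0 xy≈0 = begin
    y             ≈⟨ sym (*-identityˡ y) ⟩
    1# * y        ≈⟨ *-congʳ (sym (proj₂ (inverse x x≉0))) ⟩
    (x * x⁻¹) * y ≈⟨ xy∙z≈y∙xz x x⁻¹ y ⟩
    x⁻¹ * (x * y) ≈⟨ *-congˡ xy≈0 ⟩
    x⁻¹ * 0#      ≈⟨ zeroʳ _ ⟩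
    0#            ∎
    where x⁻¹ = proj₁ (inverse x x≉0)

  sign≉0 : ∀ {n} (i : Fin n) → ¬ sign i ≈ 0#
  sign≉0 i sign≈0 = 0≉1 (trans (sym (zeroˡ (sign i))) (trans (*-congʳ (sym sign≈0)) (sign*sign≈1 i)))

  addCol₀ : ∀ {n} → Square (suc n) → Vect n → Square (suc n)
  addCol₀ X l r c = X r c + X r zero * (0# ∷ l) c

  det-addCol₀ : ∀ {n} (X : Square (suc n)) l → det (addCol₀ X l) ≈ det X
  det-addCol₀ {n} X l = begin
    det (addCol₀ X l)                                                  ≈⟨ det-+-outer X col₀ (0# ∷ l) ⟩
    det X + ∑[ k < suc n ] ((0# ∷ l) k * det (replaceColumn X k col₀)) ≈⟨ +-congˡ (sum-zero {suc n} term≈0) ⟩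
    det X + 0#                                                         ≈⟨ +-identityʳ _ ⟩
    det X                                                              ∎
    where
    col₀ = λ r → X r zero
    term≈0 : ∀ k → (0# ∷ l) k * det (replaceColumn X k col₀) ≈ 0#
    term≈0 zero    = zeroˡ _
    term≈0 (suc k) = trans (*-congˡ (det-alternating (replaceColumn X (suc k) col₀) {zero} {suc k} (λ ())
                       (λ r → sym (reflexive (updateAt-updates k (λ b → X r (suc b))))))) (zeroʳ _)

  addCol₀-indep : ∀ {n} (X : Square (suc n)) l → IndepCols X → IndepCols (addCol₀ X l)
  addCol₀-indep {n} X l indep z X′z≈0 = z≈0
    where
    s = ∑[ c < suc n ] ((0# ∷ l) c * z c)
    w : Vect (suc n)
    w = (z zero + s) ∷ (z ∘ suc)
    Xw≈X′z : ∀ r → (X · w) r ≈ (addCol₀ X l · z) r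
    Xw≈X′z r = begin
      (X · w) r                                                    ≈⟨ ·-sum X w r ⟩
      X r zero * (z zero + s) + ∑[ b < n ] (X r (suc b) * z (suc b))
        ≈⟨ +-congʳ (distribˡ (X r zero) (z zero) s) ⟩
      (X r zero * z zero + X r zero * s) + ∑[ b < n ] (X r (suc b) * z (suc b))
        ≈⟨ [x+y]+z≈[x+z]+y _ _ _ ⟩
      ∑[ c < suc n ] (X r c * z c) + X r zero * s                  ≈⟨ sym (∑-+-scaled (X r) (0# ∷ l) z (X r zero)) ⟩
      ∑[ c < suc n ] (addCol₀ X l r c * z c)                       ≈⟨ sym (·-sum (addCol₀ X l) z r) ⟩
      (addCol₀ X l · z) r                                          ∎
    w≈0 : w ≈ᵥ 0ᵥ
    w≈0 = indep w (λ r → trans (Xw≈X′z r) (X′z≈0 r))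
    s≈0 : s ≈ 0#
    s≈0 = trans (+-cong (zeroˡ _) (sum-zero {n} (λ b → trans (*-congˡ (w≈0 (suc b))) (zeroʳ _)))) (+-identityʳ 0#)
    z≈0 : z ≈ᵥ 0ᵥ
    z≈0 zero    = trans (sym (trans (+-congˡ s≈0) (+-identityʳ _))) (w≈0 zero)
    z≈0 (suc b) = w≈0 (suc b)

  rowCleared-indep : ∀ {n} (X : Square (suc n)) i → IndepCols X →
                     (∀ b → X i (suc b) ≈ 0#) → IndepCols (minor X i)
  rowCleared-indep {n} X i indep row≈0 y minor·y≈0 b = indep z Xz≈0 (suc b)
    where
    z : Vect (suc n)
    z = 0# ∷ y
    Xz≈0 : (X · z) ≈ᵥ 0ᵥ
    Xz≈0 r = trans (·-sum X z r) (trans (+-cong (zeroʳ _) (tail≈0 r)) (+-identityʳ 0#))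
      where
      tail≈0 : ∀ r → ∑[ b < n ] (X r (suc b) * y b) ≈ 0#
      tail≈0 r with r ≟ i
      ... | yes ≡.refl = sum-zero {n} (λ b → trans (*-congʳ (row≈0 b)) (zeroˡ _))
      ... | no r≢i     = begin
        ∑[ b < n ] (X r (suc b) * y b)  ≡⟨ ≡.cong (λ r → ∑[ b < n ] (X r (suc b) * y b)) (≡.sym (punchIn-punchOut i≢r)) ⟩
        ∑[ b < n ] (minor X i (punchOut i≢r) b * y b) ≈⟨ sym (·-sum (minor X i) y _) ⟩
        (minor X i · y) (punchOut i≢r) ≈⟨ minor·y≈0 _ ⟩
        0#                             ∎
        where i≢r = r≢i ∘ ≡.sym

  det-rowCleared : ∀ {n} (X : Square (suc n)) i → (∀ b → X i (suc b) ≈ 0#) →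
                   det X ≈ (sign i * X i zero) * det (minor X i)
  det-rowCleared X i row≈0 = sum-single _ i λ r r≢i →
    trans (*-congˡ {sign r * X r zero} (det-zeroRow (minor X r) (punchOut r≢i) (λ b →
      trans (reflexive (≡.cong (λ s → X s (suc b)) (punchIn-punchOut r≢i))) (row≈0 b)))) (zeroʳ _)

  det≉0 : ∀ {n} (X : Square n) → IndepCols X → ¬ det X ≈ 0#
  det≉0 {zero}  X _      det≈0 = 0≉1 (sym det≈0)
  det≉0 {suc n} X indep det≈0 = ¬¬-∀-Fin (suc n) col₀-entry≈0 col₀≉0
    where
    col₀≉0 : ¬ (∀ i → X i zero ≈ 0#)
    col₀≉0 col₀≈0 = 0≉1 (sym (indep (unit zero) (λ r → trans (·-unit X zero r) (col₀≈0 r)) zero))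
    -- A nonzero entry in column 0 is a pivot: clearing its row leaves a nonsingular minor.
    col₀-entry≈0 : ∀ i → ¬ ¬ (X i zero ≈ 0#)
    col₀-entry≈0 i p≉0 = det≉0 (minor X′ i) (rowCleared-indep X′ i (addCol₀-indep X l indep) row≈0) det-minor≈0
      where
      p = X i zero
      p⁻¹ = proj₁ (inverse p p≉0)
      l : Vect n
      l b = - (p⁻¹ * X i (suc b))
      X′ = addCol₀ X l
      row≈0 : ∀ b → X′ i (suc b) ≈ 0#
      row≈0 b = begin
        X i (suc b) + p * - (p⁻¹ * X i (suc b)) ≈⟨ +-congˡ (sym (-‿distribʳ-* p _)) ⟩
        X i (suc b) - p * (p⁻¹ * X i (suc b))   ≈⟨ +-congˡ (-‿cong (sym (*-assoc p p⁻¹ _))) ⟩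
        X i (suc b) - (p * p⁻¹) * X i (suc b)   ≈⟨ +-congˡ (-‿cong (trans (*-congʳ (proj₂ (inverse p p≉0))) (*-identityˡ _))) ⟩
        X i (suc b) - X i (suc b)               ≈⟨ -‿inverseʳ _ ⟩
        0#                                      ∎
      pivot≉0 : ¬ sign i * X′ i zero ≈ 0#
      pivot≉0 eq = p≉0 (x*y≈0⇒y≈0 (sign≉0 i) (trans (*-congˡ (sym (trans (+-congˡ (zeroʳ p)) (+-identityʳ p)))) eq))
      det-minor≈0 : det (minor X′ i) ≈ 0#
      det-minor≈0 = x*y≈0⇒y≈0 pivot≉0 (trans (sym (det-rowCleared X′ i row≈0)) (trans (det-addCol₀ X l) det≈0))

  toFront : ∀ {n} → Fin (suc n) → Fin (suc n) → Fin (suc n)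
  toFront j zero    = j
  toFront j (suc k) = punchIn j k

  toFront-indep : ∀ {n} (G : Square (suc n)) j → IndepCols G → IndepCols (λ r c → G r (toFront j c))
  toFront-indep {n} G j indep z Gⱼz≈0 = z≈0
    where
    Gⱼ : Square (suc n)
    Gⱼ r c = G r (toFront j c)
    z′ = insertAt (z ∘ suc) j (z zero)
    Gz′≈0 : (G · z′) ≈ᵥ 0ᵥ
    Gz′≈0 r = begin
      (G · z′) r                                                 ≈⟨ ·-sum G z′ r ⟩
      ∑[ c < suc n ] (G r c * z′ c)                              ≈⟨ sum-remove {i = j} (λ c → G r c * z′ c) ⟩
      G r j * z′ j + ∑[ k < n ] (G r (punchIn j k) * z′ (punchIn j k))
        ≡⟨ ≡.cong₂ (λ x y → G r j * x + y) (insertAt-lookup (z ∘ suc) j (z zero))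
             (sum-cong-≗ (λ k → ≡.cong (G r (punchIn j k) *_) (insertAt-punchIn (z ∘ suc) j (z zero) k))) ⟩
      ∑[ c < suc n ] (Gⱼ r c * z c)                              ≈⟨ ·-sum Gⱼ z r ⟨
      (Gⱼ · z) r                                                 ≈⟨ Gⱼz≈0 r ⟩
      0#                                                         ∎
    z≈0 : z ≈ᵥ 0ᵥ
    z≈0 zero    = trans (reflexive (≡.sym (insertAt-lookup (z ∘ suc) j (z zero)))) (indep z′ Gz′≈0 j)
    z≈0 (suc k) = trans (reflexive (≡.sym (insertAt-punchIn (z ∘ suc) j (z zero) k))) (indep z′ Gz′≈0 (punchIn j k))

  LeftInverse : ∀ {m n} → Mat n m → Mat m n → Set ℓ
  LeftInverse L M = ∀ i j → (L ⊗ M) i j ≈ δ i j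

  -- Cofactor formula; moving column j to the front avoids tracking the sign of a column permutation.
  square-leftInverse : ∀ {n} (G : Square n) → IndepCols G → Σ (Square n) λ N → LeftInverse N G
  square-leftInverse {zero}  G _     = (λ ()) , (λ ())
  square-leftInverse {suc n} G indep = N , N⊗G≈δ
    where
    Gⱼ : Fin (suc n) → Square (suc n)
    Gⱼ j r c = G r (toFront j c)
    det⁻¹ : Fin (suc n) → Carrier
    det⁻¹ j = proj₁ (inverse (det (Gⱼ j)) (det≉0 (Gⱼ j) (toFront-indep G j indep)))
    N : Square (suc n)
    N j r = det⁻¹ j * cofactor (Gⱼ j) r
    N⊗G≈δ : ∀ j c → (N ⊗ G) j c ≈ δ j c
    N⊗G≈δ j c = begin
      (N ⊗ G) j c                                          ≈⟨ ⊗-sum N G j c ⟩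
      ∑[ r < suc n ] ((det⁻¹ j * cofactor (Gⱼ j) r) * G r c) ≈⟨ sum-cong-≋ {suc n} (λ r → *-assoc (det⁻¹ j) (cofactor (Gⱼ j) r) (G r c)) ⟩
      ∑[ r < suc n ] (det⁻¹ j * (cofactor (Gⱼ j) r * G r c)) ≈⟨ *-distribˡ-sum (det⁻¹ j) (λ r → cofactor (Gⱼ j) r * G r c) ⟨
      det⁻¹ j * ∑[ r < suc n ] (cofactor (Gⱼ j) r * G r c)   ≈⟨ expansion (j ≟ c) ⟩
      δ j c                                                ∎
      where
      expansion : Dec (j ≡ c) → det⁻¹ j * ∑[ r < suc n ] (cofactor (Gⱼ j) r * G r c) ≈ δ j c
      expansion (yes ≡.refl) = begin
        det⁻¹ j * ∑[ r < suc n ] (cofactor (Gⱼ j) r * G r j) ≈⟨ *-congˡ (∑-cofactor*col₀ (Gⱼ j)) ⟩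
        det⁻¹ j * det (Gⱼ j)                               ≈⟨ *-comm _ _ ⟩
        det (Gⱼ j) * det⁻¹ j                               ≈⟨ proj₂ (inverse _ _) ⟩
        1#                                                 ≈⟨ δ-diag j ⟨
        δ j j                                              ∎
      expansion (no j≢c) = begin
        det⁻¹ j * ∑[ r < suc n ] (cofactor (Gⱼ j) r * G r c)
          ≡⟨ ≡.cong (λ c → det⁻¹ j * ∑[ r < suc n ] (cofactor (Gⱼ j) r * G r c)) (≡.sym (punchIn-punchOut j≢c)) ⟩
        det⁻¹ j * ∑[ r < suc n ] (cofactor (Gⱼ j) r * Gⱼ j r (suc (punchOut j≢c)))
          ≈⟨ *-congˡ (∑-cofactor*col-suc (Gⱼ j) (punchOut j≢c)) ⟩
        det⁻¹ j * 0#  ≈⟨ zeroʳ _ ⟩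
        0#            ≈⟨ δ-≢ j≢c ⟨
        δ j c         ∎

  ⊗-assoc : ∀ {m n p q} (A : Mat m n) (C : Mat n p) (D : Mat p q) i j → ((A ⊗ C) ⊗ D) i j ≈ (A ⊗ (C ⊗ D)) i j
  ⊗-assoc A C D i j = ⊗-· A C (λ r → D r j) i

  -- R is the identity on im R = im C, so solving C H = R column by column gives H C = 1.
  idempotent-retraction : ∀ {m k} (R : Mat m m) (C : Mat m k) → Idempotent R →
    (∀ x → InIm R x → InIm C x) → (∀ x → InIm C x → InIm R x) → IndepCols C →
    Σ (Mat k m) λ H → ∀ y → (H · (C · y)) ≈ᵥ y
  idempotent-retraction {m} {k} R C idem imR⊆imC imC⊆imR indepC = H , HC≈id
    where
    Rcol∈imC : ∀ j → InIm C (λ i → R i j)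
    Rcol∈imC j = imR⊆imC _ (unit j , ·-unit R j)
    H : Mat k m
    H r j = proj₁ (Rcol∈imC j) r
    CH≈R : ∀ x → (C · (H · x)) ≈ᵥ (R · x)
    CH≈R x i = trans (sym (⊗-· C H x i)) (·-congˡ x (λ i j → proj₂ (Rcol∈imC j) i) i)
    HC≈id : ∀ y → (H · (C · y)) ≈ᵥ y
    HC≈id y i = x∙y⁻¹≈ε⇒x≈y _ _ (indepC d Cd≈0 i)
      where
      x = C · y
      x′ = proj₁ (imC⊆imR x (y , λ _ → refl))
      Rx′≈x = proj₂ (imC⊆imR x (y , λ _ → refl))
      Rx≈x : (R · x) ≈ᵥ x
      Rx≈x i = trans (·-congʳ R (λ j → sym (Rx′≈x j)) i) (trans (idem x′ i) (Rx′≈x i))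
      d : Vect k
      d r = (H · x) r - y r
      Cd≈0 : (C · d) ≈ᵥ 0ᵥ
      Cd≈0 i = trans (·-distrib-− C (H · x) y i) (trans (+-congʳ (trans (CH≈R x i) (Rx≈x i))) (-‿inverseʳ _))

  leftInverse-via-retraction : ∀ {m k} (C : Mat m k) (H : Mat k m) (M : Mat m k) →
    (∀ y → (H · (C · y)) ≈ᵥ y) → (∀ z → InIm C (M · z)) → IndepCols M → Σ (Mat k m) λ L → LeftInverse L M
  leftInverse-via-retraction {m} {k} C H M HC≈id imM⊆imC indepM = N ⊗ H , L⊗M≈δ
    where
    HM-indep : IndepCols (H ⊗ M)
    HM-indep z HMz≈0 = indepM z Mz≈0
      where
      y = proj₁ (imM⊆imC z)
      Cy≈Mz = proj₂ (imM⊆imC z)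
      y≈0 : y ≈ᵥ 0ᵥ
      y≈0 i = trans (sym (HC≈id y i)) (trans (·-congʳ H Cy≈Mz i) (trans (sym (⊗-· H M z i)) (HMz≈0 i)))
      Mz≈0 : (M · z) ≈ᵥ 0ᵥ
      Mz≈0 i = trans (sym (Cy≈Mz i)) (trans (·-congʳ C y≈0 i) (·-0ᵥ C i))
    N = proj₁ (square-leftInverse (H ⊗ M) HM-indep)
    L⊗M≈δ : LeftInverse (N ⊗ H) M
    L⊗M≈δ i j = trans (⊗-assoc N H M i j) (proj₂ (square-leftInverse (H ⊗ M) HM-indep) i j)

  restriction-leftInverse : ∀ {m k} (T₂ R : Mat m m) (B : Mat m k) → Idempotent R → SameImage R T₂ →
    DimImage T₂ k → IndepCols B → (∀ z → (T₂ · (B · z)) ≈ᵥ 0ᵥ → (B · z) ≈ᵥ 0ᵥ) →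
    Σ (Mat k m) λ L → LeftInverse L (T₂ ⊗ B)
  restriction-leftInverse T₂ R B idem imR≡imT₂ (C , indepC , imT₂≡imC) indepB ker∩H≈0 =
    leftInverse-via-retraction C H (T₂ ⊗ B) HC≈id imT₂B⊆imC indepT₂B
    where
    retraction = idempotent-retraction R C idem
      (λ x → proj₁ (imT₂≡imC x) ∘ proj₁ (imR≡imT₂ x)) (λ x → proj₂ (imR≡imT₂ x) ∘ proj₂ (imT₂≡imC x)) indepC
    H = proj₁ retraction
    HC≈id = proj₂ retraction
    imT₂B⊆imC : ∀ z → InIm C ((T₂ ⊗ B) · z)
    imT₂B⊆imC z = proj₁ (imT₂≡imC _) (B · z , λ i → sym (⊗-· T₂ B z i))
    indepT₂B : IndepCols (T₂ ⊗ B)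
    indepT₂B z T₂Bz≈0 = indepB z (ker∩H≈0 z (λ i → trans (sym (⊗-· T₂ B z i)) (T₂Bz≈0 i)))

  intertwining : ∀ {m k} (T₁ T₂ R : Mat m m) (B : Mat m k) (T : Mat k k) →
    (∀ z → (T₂ · (B · (T · z))) ≈ᵥ (R · (T₁ · (B · z)))) → ∀ i j → ((R ⊗ T₁) ⊗ B) i j ≈ ((T₂ ⊗ B) ⊗ T) i j
  intertwining T₁ T₂ R B T T-represents = ·-ext λ v i → begin
    (((R ⊗ T₁) ⊗ B) · v) i    ≈⟨ ⊗-· (R ⊗ T₁) B v i ⟩
    ((R ⊗ T₁) · (B · v)) i    ≈⟨ ⊗-· R T₁ (B · v) i ⟩
    (R · (T₁ · (B · v))) i    ≈⟨ T-represents v i ⟨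
    (T₂ · (B · (T · v))) i    ≈⟨ ⊗-· T₂ B (T · v) i ⟨
    ((T₂ ⊗ B) · (T · v)) i    ≈⟨ ⊗-· (T₂ ⊗ B) T v i ⟨
    (((T₂ ⊗ B) ⊗ T) · v) i    ∎

module CauchyBinet₂ {c ℓ} (R : CommutativeRing c ℓ) where

  open CommutativeRing R hiding (zero)
  open import Algebra.Properties.Ring ring using (x[y-z]≈xy-xz)
  open Determinant R using (sum; sum-syntax; sum-cong-≋; ∑-comm; ∑-distrib-+; *-distribˡ-sum; *-distribʳ-sum; -‿distrib-sum)
  import Algebra.Solver.CommutativeMonoid *-commutativeMonoid as *-Solver
  open import Relation.Binary.Reasoning.Setoid setoid

  sum*sum : ∀ {m n} (f : Fin m → Carrier) (g : Fin n → Carrier) →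
            sum f * sum g ≈ ∑[ p < m ] ∑[ q < n ] (f p * g q)
  sum*sum {m} f g = trans (*-distribʳ-sum (sum g) f) (sum-cong-≋ {m} (λ p → *-distribˡ-sum (f p) g))

  cauchy-binet₂ : ∀ {n} (x y a b : Fin n → Carrier) →
    ∑[ p < n ] (x p * a p) * ∑[ q < n ] (y q * b q) - ∑[ p < n ] (y p * a p) * ∑[ q < n ] (x q * b q)
    ≈ ∑[ p < n ] ∑[ q < n ] ((x p * y q) * (a p * b q - a q * b p))
  cauchy-binet₂ {n} x y a b = sym (begin
    ∑[ p < n ] ∑[ q < n ] ((x p * y q) * (a p * b q - a q * b p))
      ≈⟨ sum-cong-≋ {n} (λ p → sum-cong-≋ {n} (λ q → expand p q)) ⟩
    ∑[ p < n ] ∑[ q < n ] (A p q - B p q)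
      ≈⟨ sum-cong-≋ {n} (λ p → trans (∑-distrib-+ (A p) (λ q → - B p q)) (+-congˡ (sym (-‿distrib-sum (B p))))) ⟩
    ∑[ p < n ] (∑[ q < n ] A p q - ∑[ q < n ] B p q)
      ≈⟨ trans (∑-distrib-+ (λ p → sum (A p)) (λ p → - sum (B p))) (+-congˡ (sym (-‿distrib-sum (λ p → sum (B p))))) ⟩
    ∑[ p < n ] ∑[ q < n ] A p q - ∑[ p < n ] ∑[ q < n ] B p q
      ≈⟨ +-cong (sym (sum*sum (λ p → x p * a p) (λ q → y q * b q)))
                (-‿cong (trans (∑-comm B) (sym (sum*sum (λ q → y q * a q) (λ p → x p * b p))))) ⟩
    ∑[ p < n ] (x p * a p) * ∑[ q < n ] (y q * b q) - ∑[ p < n ] (y p * a p) * ∑[ q < n ] (x q * b q) ∎)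
    where
    open *-Solver using (solve; _⊕_; _⊜_)
    A B : Fin n → Fin n → Carrier
    A p q = (x p * a p) * (y q * b q)
    B p q = (y q * a q) * (x p * b p)
    expand : ∀ p q → (x p * y q) * (a p * b q - a q * b p) ≈ A p q - B p q
    expand p q = trans (x[y-z]≈xy-xz _ _ _) (+-cong
      (solve 4 (λ xp yq ap bq → (xp ⊕ yq) ⊕ (ap ⊕ bq) ⊜ (xp ⊕ ap) ⊕ (yq ⊕ bq)) refl (x p) (y q) (a p) (b q))
      (-‿cong (solve 4 (λ xp yq aq bp → (xp ⊕ yq) ⊕ (aq ⊕ bp) ⊜ (yq ⊕ aq) ⊕ (xp ⊕ bp)) refl (x p) (y q) (a q) (b p))))

module PolynomialIdeals {c ℓ} (F : Field c ℓ) (n : ℕ) where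

  open Over F using (Mat; _⊗_; Poly; con; _⊕_; _⊛_; ⊝_; _≃_; sumₚ; _∈⟨_⟩; SameIdeal; _·ₚ_; minors)
  open Over._≃_ renaming (distribˡ to ⊛-distribˡ-⊕)
  module K = Field F
  module KM = Matrix F
  open KM using (LeftInverse; δ)

  polyRing : CommutativeRing c (c ⊔ ℓ)
  polyRing = record
    { Carrier = Poly n ; _≈_ = _≃_ ; _+_ = _⊕_ ; _*_ = _⊛_ ; -_ = ⊝_ ; 0# = con K.0# ; 1# = con K.1#
    ; isCommutativeRing = record
      { isRing = record
        { +-isAbelianGroup = record
          { isGroup = record
            { isMonoid = record
              { isSemigroup = record
                { isMagma = record
                  { isEquivalence = record { refl = ≃-refl ; sym = ≃-sym ; trans = ≃-trans }
                  ; ∙-cong = ⊕-cong }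
                ; assoc = ⊕-assoc }
              ; identity = (λ p → ≃-trans (⊕-comm _ _) (⊕-idʳ p)) , ⊕-idʳ }
            ; inverse = (λ p → ≃-trans (⊕-comm _ _) (⊕-invʳ p)) , ⊕-invʳ
            ; ⁻¹-cong = ⊝-cong }
          ; comm = ⊕-comm }
        ; *-cong = ⊛-cong
        ; *-assoc = ⊛-assoc
        ; *-identity = (λ p → ≃-trans (⊛-comm _ _) (⊛-idʳ p)) , ⊛-idʳ
        ; distrib = ⊛-distribˡ-⊕ , λ p q r → ≃-trans (⊛-comm _ _) (≃-trans (⊛-distribˡ-⊕ p q r) (⊕-cong (⊛-comm _ _) (⊛-comm _ _))) }
      ; *-comm = ⊛-comm } }

  open CommutativeRing polyRing hiding (zero)
  open Determinant polyRing using (sum; sum-syntax; sum-cong-≋; sum-single; ∑-comm; *-distribˡ-sum; *-distribʳ-sum)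
  open CauchyBinet₂ polyRing using (cauchy-binet₂)
  open import Algebra.Properties.Ring ring using (-1*x≈-x; ⁻¹-anti-homo‿-)
  open import Relation.Binary.Reasoning.Setoid setoid

  module _ {I : Set c} (g : I → Poly n) where

    ∈-resp-≈ : ∀ {p q} → p ≈ q → p ∈⟨ g ⟩ → q ∈⟨ g ⟩
    ∈-resp-≈ p≈q (r , idx , coeff , p≈) = r , idx , coeff , trans (sym p≈q) p≈

    0∈ : 0# ∈⟨ g ⟩
    0∈ = 0 , (λ ()) , (λ ()) , refl

    generator∈ : ∀ i → g i ∈⟨ g ⟩
    generator∈ i = 1 , (λ _ → i) , (λ _ → 1#) , sym (trans (+-identityʳ _) (*-identityˡ _))

    term+∈ : ∀ a i {p} → p ∈⟨ g ⟩ → (a * g i + p) ∈⟨ g ⟩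
    term+∈ a i (r , idx , coeff , p≈) = suc r , i ∷ idx , a ∷ coeff , +-congˡ p≈

    combination+∈ : ∀ r (idx : Fin r → I) (coeff : Fin r → Poly n) {q} → q ∈⟨ g ⟩ → (sumₚ r (λ s → coeff s * g (idx s)) + q) ∈⟨ g ⟩
    combination+∈ zero    idx coeff q∈ = ∈-resp-≈ (sym (+-identityˡ _)) q∈
    combination+∈ (suc r) idx coeff q∈ =
      ∈-resp-≈ (sym (+-assoc _ _ _)) (term+∈ (coeff zero) (idx zero) (combination+∈ r (idx ∘ suc) (coeff ∘ suc) q∈))

    +-∈ : ∀ {p q} → p ∈⟨ g ⟩ → q ∈⟨ g ⟩ → (p + q) ∈⟨ g ⟩
    +-∈ (r , idx , coeff , p≈) q∈ = ∈-resp-≈ (+-congʳ (sym p≈)) (combination+∈ r idx coeff q∈)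

    *-combination∈ : ∀ a r (idx : Fin r → I) (coeff : Fin r → Poly n) → (a * sumₚ r (λ s → coeff s * g (idx s))) ∈⟨ g ⟩
    *-combination∈ a zero    idx coeff = ∈-resp-≈ (sym (zeroʳ a)) 0∈
    *-combination∈ a (suc r) idx coeff =
      ∈-resp-≈ (sym (trans (distribˡ a _ _) (+-congʳ (sym (*-assoc _ _ _)))))
               (term+∈ (a * coeff zero) (idx zero) (*-combination∈ a r (idx ∘ suc) (coeff ∘ suc)))

    *-∈ : ∀ a {p} → p ∈⟨ g ⟩ → (a * p) ∈⟨ g ⟩
    *-∈ a (r , idx , coeff , p≈) = ∈-resp-≈ (*-congˡ (sym p≈)) (*-combination∈ a r idx coeff)

    sum-∈ : ∀ {k} (f : Fin k → Poly n) → (∀ i → f i ∈⟨ g ⟩) → sum f ∈⟨ g ⟩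
    sum-∈ {zero}  f f∈ = 0∈
    sum-∈ {suc k} f f∈ = +-∈ (f∈ zero) (sum-∈ (f ∘ suc) (f∈ ∘ suc))

  ∈⟨⟩-trans : ∀ {I J : Set c} (g : I → Poly n) (h : J → Poly n) {p} → p ∈⟨ h ⟩ → (∀ j → h j ∈⟨ g ⟩) → p ∈⟨ g ⟩
  ∈⟨⟩-trans {J = J} g h (r , idx , coeff , p≈) h⊆g = ∈-resp-≈ g (sym p≈) (combination∈ r idx coeff)
    where
    combination∈ : ∀ r (idx : Fin r → J) (coeff : Fin r → Poly n) → sumₚ r (λ s → coeff s * h (idx s)) ∈⟨ g ⟩
    combination∈ zero    idx coeff = 0∈ g
    combination∈ (suc r) idx coeff =
      +-∈ g (*-∈ g (coeff zero) (h⊆g (idx zero))) (combination∈ r (idx ∘ suc) (coeff ∘ suc))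

  sumₚ≡sum : ∀ k (f : Fin k → Poly n) → sumₚ k f ≡ sum f
  sumₚ≡sum zero    f = ≡.refl
  sumₚ≡sum (suc k) f = ≡.cong (f zero +_) (sumₚ≡sum k (f ∘ suc))

  ·ₚ-sum : ∀ {m k} (A : Mat m k) (v : Fin k → Poly n) i → (A ·ₚ v) i ≈ ∑[ j < k ] (con (A i j) * v j)
  ·ₚ-sum {k = k} A v i = reflexive (sumₚ≡sum k _)

  con-sum : ∀ {k} (f : Fin k → K.Carrier) → con (KM.sum f) ≈ ∑[ j < k ] con (f j)
  con-sum {zero}  f = refl
  con-sum {suc k} f = trans (con-+ _ _) (+-congˡ (con-sum (f ∘ suc)))

  ·ₚ-congˡ : ∀ {m k} {A A′ : Mat m k} (v : Fin k → Poly n) → (∀ i j → A i j K.≈ A′ i j) →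
             ∀ i → (A ·ₚ v) i ≈ (A′ ·ₚ v) i
  ·ₚ-congˡ {k = k} {A} {A′} v A≈A′ i =
    trans (·ₚ-sum A v i) (trans (sum-cong-≋ {k} (λ j → *-congʳ (con-cong (A≈A′ i j)))) (sym (·ₚ-sum A′ v i)))

  ·ₚ-congʳ : ∀ {m k} (A : Mat m k) {v w : Fin k → Poly n} → (∀ j → v j ≈ w j) →
             ∀ i → (A ·ₚ v) i ≈ (A ·ₚ w) i
  ·ₚ-congʳ {k = k} A {v} {w} v≈w i =
    trans (·ₚ-sum A v i) (trans (sum-cong-≋ {k} (λ j → *-congˡ (v≈w j))) (sym (·ₚ-sum A w i)))

  ·ₚ-⊗ : ∀ {m k p} (A : Mat m k) (B : Mat k p) (v : Fin p → Poly n) i → (A ·ₚ (B ·ₚ v)) i ≈ ((A ⊗ B) ·ₚ v) i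
  ·ₚ-⊗ {m} {k} {p} A B v i = begin
    (A ·ₚ (B ·ₚ v)) i                                     ≈⟨ ·ₚ-sum A _ i ⟩
    ∑[ r < k ] (con (A i r) * (B ·ₚ v) r)                 ≈⟨ sum-cong-≋ {k} (λ r → *-congˡ (·ₚ-sum B v r)) ⟩
    ∑[ r < k ] (con (A i r) * ∑[ j < p ] (con (B r j) * v j))
      ≈⟨ sum-cong-≋ {k} (λ r → trans (*-distribˡ-sum (con (A i r)) (λ j → con (B r j) * v j))
                                      (sum-cong-≋ {p} (λ j → sym (*-assoc _ _ _)))) ⟩
    ∑[ r < k ] ∑[ j < p ] ((con (A i r) * con (B r j)) * v j) ≈⟨ ∑-comm (λ r j → (con (A i r) * con (B r j)) * v j) ⟩
    ∑[ j < p ] ∑[ r < k ] ((con (A i r) * con (B r j)) * v j)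
      ≈⟨ sum-cong-≋ {p} (λ j → sym (*-distribʳ-sum (v j) (λ r → con (A i r) * con (B r j)))) ⟩
    ∑[ j < p ] (∑[ r < k ] (con (A i r) * con (B r j)) * v j)
      ≈⟨ sum-cong-≋ {p} (λ j → *-congʳ (sym (entry j))) ⟩
    ∑[ j < p ] (con ((A ⊗ B) i j) * v j)                  ≈⟨ sym (·ₚ-sum (A ⊗ B) v i) ⟩
    ((A ⊗ B) ·ₚ v) i                                      ∎
    where
    entry : ∀ j → con ((A ⊗ B) i j) ≈ ∑[ r < k ] (con (A i r) * con (B r j))
    entry j = trans (con-cong (KM.⊗-sum A B i j))
                    (trans (con-sum (λ r → A i r K.* B r j)) (sum-cong-≋ {k} (λ r → con-* _ _)))

  ·ₚ-identity : ∀ {k} {A : Mat k k} (v : Fin k → Poly n) → (∀ i j → A i j K.≈ δ i j) → ∀ i → (A ·ₚ v) i ≈ v i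
  ·ₚ-identity {k} {A} v A≈δ i = begin
    (A ·ₚ v) i                           ≈⟨ ·ₚ-sum A v i ⟩
    ∑[ j < k ] (con (A i j) * v j)       ≈⟨ sum-single _ i (λ j j≢i → trans (*-congʳ (con-cong
                                              (K.trans (A≈δ i j) (KM.δ-≢ (j≢i ∘ ≡.sym))))) (zeroˡ _)) ⟩
    con (A i i) * v i                    ≈⟨ *-congʳ (con-cong (K.trans (A≈δ i i) (KM.δ-diag i))) ⟩
    1# * v i                             ≈⟨ *-identityˡ _ ⟩
    v i                                  ∎

  antisymmetric-minor∈ : ∀ {k} (a b : Fin k → Poly n) p q → (a p * b q - a q * b p) ∈⟨ minors a b ⟩
  antisymmetric-minor∈ a b p q with <-cmp p q
  ... | tri< p<q _ _ = generator∈ (minors a b) (lift ((p , q) , p<q))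
  ... | tri≈ _ ≡.refl _ = ∈-resp-≈ (minors a b) (sym (-‿inverseʳ _)) (0∈ (minors a b))
  ... | tri> _ _ q<p = ∈-resp-≈ (minors a b) (trans (-1*x≈-x _) (⁻¹-anti-homo‿- _ _))
                         (*-∈ (minors a b) (- 1#) (generator∈ (minors a b) (lift ((q , p) , q<p))))

  minors-⊆ : ∀ {k m} (P : Mat m k) {a b : Fin k → Poly n} {A C : Fin m → Poly n} →
             (∀ i → A i ≈ (P ·ₚ a) i) → (∀ i → C i ≈ (P ·ₚ b) i) → ∀ x → minors A C x ∈⟨ minors a b ⟩
  minors-⊆ {k} P {a} {b} {A} {C} A≈Pa C≈Pb (lift ((i , j) , _)) =
    ∈-resp-≈ (minors a b) (sym expansion)
      (sum-∈ (minors a b) _ λ p → sum-∈ (minors a b) _ λ q → *-∈ (minors a b) (x p * y q) (antisymmetric-minor∈ a b p q))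
    where
    x y : Fin k → Poly n
    x p = con (P i p)
    y q = con (P j q)
    expansion : A i * C j - A j * C i ≈ ∑[ p < k ] ∑[ q < k ] ((x p * y q) * (a p * b q - a q * b p))
    expansion = trans (+-cong (*-cong (trans (A≈Pa i) (·ₚ-sum P a i)) (trans (C≈Pb j) (·ₚ-sum P b j)))
                              (-‿cong (*-cong (trans (A≈Pa j) (·ₚ-sum P a j)) (trans (C≈Pb i) (·ₚ-sum P b i)))))
                      (cauchy-binet₂ x y a b)

  sameIdeal-minors : ∀ {k m} {L : Mat k m} {M : Mat m k} → LeftInverse L M →
                     {a b : Fin k → Poly n} {A C : Fin m → Poly n} →
                     (∀ i → A i ≈ (M ·ₚ a) i) → (∀ i → C i ≈ (M ·ₚ b) i) → SameIdeal (minors a b) (minors A C)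
  sameIdeal-minors {L = L} {M} L⊗M≈δ {a} {b} {A} {C} A≈Ma C≈Mb p =
    (λ p∈ → ∈⟨⟩-trans (minors A C) (minors a b) p∈ (minors-⊆ L (recover a A≈Ma) (recover b C≈Mb))) ,
    (λ p∈ → ∈⟨⟩-trans (minors a b) (minors A C) p∈ (minors-⊆ M A≈Ma C≈Mb))
    where
    recover : ∀ v {V} → (∀ i → V i ≈ (M ·ₚ v) i) → ∀ q → v q ≈ (L ·ₚ V) q
    recover v V≈Mv q = sym (trans (·ₚ-congʳ L V≈Mv q) (trans (·ₚ-⊗ L M v q) (·ₚ-identity v L⊗M≈δ q)))

lemma2p2 : {c ℓ′ : Level} (F : Field c ℓ′) → let open Field F in let open Over F in
    Infinite → (m : ℕ) (T₁ T₂ R : Mat m m) → Idempotent R → SameImage R T₂ →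
    (ℓ : ℕ) → DimImage T₂ ℓ →
    (B : Mat m ℓ) → IndepCols B →
    (∀ z → (T₂ · (B · z)) ≈ᵥ 0ᵥ → (B · z) ≈ᵥ 0ᵥ) →
    (T : Mat ℓ ℓ) → (∀ z → (T₂ · (B · (T · z))) ≈ᵥ (R · (T₁ · (B · z)))) →
    SameIdeal (minors (T ·ₚ zvec) zvec) (minors (((R ⊗ T₁) ⊗ B) ·ₚ zvec) ((T₂ ⊗ B) ·ₚ zvec))
lemma2p2 F _ m T₁ T₂ R idem imR≡imT₂ ℓ dimImT₂ B indepB ker∩H≈0 T T-represents =
  sameIdeal-minors (proj₂ (restriction-leftInverse T₂ R B idem imR≡imT₂ dimImT₂ indepB ker∩H≈0))
                   RT₁Bz≃T₂B[Tz] (λ _ → ≃-refl)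
  where
  open Over F using (_⊗_; _·ₚ_; zvec; _≃_)
  open Over._≃_ using (≃-refl; ≃-sym; ≃-trans)
  open Matrix F using (restriction-leftInverse; intertwining)
  open PolynomialIdeals F ℓ
  RT₁Bz≃T₂B[Tz] : ∀ i → (((R ⊗ T₁) ⊗ B) ·ₚ zvec) i ≃ ((T₂ ⊗ B) ·ₚ (T ·ₚ zvec)) i
  RT₁Bz≃T₂B[Tz] i = ≃-trans (·ₚ-congˡ zvec (intertwining T₁ T₂ R B T T-represents) i) (≃-sym (·ₚ-⊗ (T₂ ⊗ B) T zvec i))
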